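{- Let $\lambda\in\mathbb{R}$ and $r\in\mathbb{N}\cup\{0\}$. For all $n,k\in\mathbb{N}\cup\{0\}$ with $n\ge k$, $$S_{2,r}(n+r,k+r|\lambda)=\sum_{l=k}^{n}\sum_{m=0}^{n-l}\binom{n}{l}\,r^m\,\lambda^{n-m-l}\,S_1(n-l,m)\,S_{2,\lambda}(l,k).$$
   Context: All generating functions are formal power series in $t$. For a number $y$, $(1+\lambda t)^{y/\lambda}$ denotes the formal power series $\sum_{n\ge0}(y|\lambda)_n\frac{t^n}{n!}$, where $(y|\lambda)_0=1$ and $(y|\lambda)_n=y(y-\lambda)(y-2\lambda)\cdots(y-(n-1)\lambda)$ for $n\ge1$ (for $\lambda=0$ this is the limit $e^{yt}$). The convention $0^0=1$ is used. The (signed) Stirling numbers of the first kind $S_1(n,k)$ are defined by $(x)_n=\sum_{k=0}^n S_1(n,k)x^k$, where $(x)_0=1$ and $(x)_n=x(x-1)\cdots(x-n+1)$ for $n\ge1$. The degenerate Stirling numbers of the second kind $S_{2,\lambda}(n,k)$ are defined, for $k\ge0$, by $$\frac{1}{k!}\left((1+\lambda t)^{1/\lambda}-1\right)^k=\sum_{n=k}^\infty S_{2,\lambda}(n,k)\frac{t^n}{n!}.$$ The extended degenerate Stirling numbers of the second kind $S_{2,r}(n+r,k+r|\lambda)$ are defined, for $r,k\in\mathbb{N}\cup\{0\}$, by $$\frac{1}{k!}(1+\lambda t)^{r/\lambda}\left((1+\lambda t)^{1/\lambda}-1\right)^k=\sum_{n=k}^\infty S_{2,r}(n+r,k+r|\lambda)\frac{t^n}{n!}.$$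 -}

module Defs where

open import Algebra.Bundles using (CommutativeRing; Semiring)
open import Algebra.Definitions using (Invertible)
import Algebra.Definitions.RawSemiring as RawSemiringDefs
open import Data.Fin.Base using (toℕ)
open import Data.Integer.Base as ℤ using (ℤ; +_; -[1+_])
import Data.Integer.Properties as ℤ
open import Data.Nat.Base as ℕ using (ℕ; zero; suc; NonZero; _∸_; _!)
open import Data.Nat.Properties using (_!≢0)
open import Data.Product.Base using (proj₁)
open import Level using (Level; _⊔_) renaming (suc to lsuc)

private
  variable
    c ℓ : Level

-- Commutative rings in which every positive integer is invertible.  ℝ is an
-- instance; no more of its structure enters series with denominators n! and k!.
record ℚAlgebra (c ℓ : Level) : Set (lsuc (c ⊔ ℓ)) where
  field
    commutativeRing : CommutativeRing c ℓ
  open CommutativeRing commutativeRing public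
  open RawSemiringDefs (Semiring.rawSemiring semiring) public using (_×_; _^_; sum)
  field
    invertible : ∀ n → .{{_ : NonZero n}} → Invertible _≈_ 1# _*_ (n × 1#)

  1/_! : ℕ → Carrier
  1/ n ! = proj₁ (invertible (n !) {{n !≢0}})

module RangeSum (R : CommutativeRing c ℓ) where
  open CommutativeRing R
  open RawSemiringDefs (Semiring.rawSemiring semiring) using (sum)

  -- Both end points are included; the sum is empty when b < a.
  sumFromTo : ℕ → ℕ → (ℕ → Carrier) → Carrier
  sumFromTo a b f = sum {n = suc b ∸ a} (λ i → f (a ℕ.+ toℕ i))

  infixl 5 sumFromTo
  syntax sumFromTo a b (λ i → x) = ∑[ i ∈ a ⋯ b ] x

module PowerSeries (R : CommutativeRing c ℓ) where
  open CommutativeRing R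
  open RangeSum R

  -- f n is the coefficient of tⁿ.
  Series : Set c
  Series = ℕ → Carrier

  constant : Carrier → Series
  constant a zero    = a
  constant a (suc _) = 0#

  var : Series
  var (suc zero) = 1#
  var _          = 0#

  infixl 6 _⊖_
  infixl 7 _⊛_ _·_
  infixr 8 _↑_

  _⊖_ : Series → Series → Series
  (f ⊖ g) n = f n - g n

  _⊛_ : Series → Series → Series
  (f ⊛ g) n = ∑[ i ∈ 0 ⋯ n ] f i * g (n ∸ i)

  _·_ : Carrier → Series → Series
  (a · f) n = a * f n

  _↑_ : Series → ℕ → Series
  f ↑ zero  = constant 1#
  f ↑ suc k = f ⊛ f ↑ k

module ℤSeries = PowerSeries ℤ.+-*-commutativeRing

-- x (x - 1) ⋯ (x - n + 1) as a polynomial in x, viewed inside ℤ[[x]].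
fallingPolynomial : ℕ → ℤSeries.Series
fallingPolynomial zero    = ℤSeries.constant ℤ.1ℤ
fallingPolynomial (suc n) =
  fallingPolynomial n ℤSeries.⊛ (ℤSeries.var ℤSeries.⊖ ℤSeries.constant (+ n))

-- The coefficient of xᵏ in the falling factorial.
S₁ : ℕ → ℕ → ℤ
S₁ n k = fallingPolynomial n k

module Degenerate (A : ℚAlgebra c ℓ) where
  open ℚAlgebra A
  open RangeSum commutativeRing public
  open PowerSeries commutativeRing

  fromℕ : ℕ → Carrier
  fromℕ n = n × 1#

  fromℤ : ℤ → Carrier
  fromℤ (+ n)    = fromℕ n
  fromℤ -[1+ n ] = - fromℕ (suc n)

  -- (y ∣ μ)ₙ = y (y - μ) ⋯ (y - (n - 1) μ)
  falling : (y μ : Carrier) → ℕ → Carrier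
  falling y μ zero    = 1#
  falling y μ (suc n) = falling y μ n * (y - n × μ)

  -- (1 + μ t)^(y / μ), which for μ = 0 is exp (y t).
  degExp : (μ y : Carrier) → Series
  degExp μ y n = falling y μ n * 1/ n !

  -- n! [tⁿ] f, so that f = Σₙ (egfCoeff f n) tⁿ / n!.
  egfCoeff : Series → ℕ → Carrier
  egfCoeff f n = (n !) × f n

  -- The series has order at least k, so its expansion starts at n = k.
  S₂ : (μ : Carrier) → ℕ → ℕ → Carrier
  S₂ μ n k = egfCoeff (1/ k ! · (degExp μ 1# ⊖ constant 1#) ↑ k) n

  -- S₂ᵣ μ r n k is S_{2,r}(n + r, k + r | μ): the indices are the unshifted ones.
  S₂ᵣ : (μ : Carrier) (r n k : ℕ) → Carrier
  S₂ᵣ μ r n k =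
    egfCoeff (1/ k ! · (degExp μ (fromℕ r) ⊛ (degExp μ 1# ⊖ constant 1#) ↑ k)) n

{-# OPTIONS --safe #-}

-- Write F = ((1 + μt)^(1/μ) - 1)ᵏ / k!.  The product (1 + μt)^(r/μ) F is a
-- binomial convolution of (r ∣ μ)ⱼ with S₂ μ l k.  The terms with l < k vanish
-- because F has order at least k, and homogenising x (x - 1) ⋯ (x - j + 1) =
-- Σₘ S₁(j, m) xᵐ gives (r ∣ μ)ⱼ = Σₘ S₁(j, m) rᵐ μʲ⁻ᵐ.
module Submission where

open import Algebra.Bundles using (CommutativeRing)
import Algebra.Properties.AbelianGroup as AbelianGroupProperties
import Algebra.Properties.Ring as RingProperties
import Algebra.Properties.Semiring.Mult as MultProperties
import Algebra.Properties.Semiring.Sum as SumProperties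
import Algebra.Solver.Ring.NaturalCoefficients.Default as SemiringSolver
open import Data.Fin.Base using (Fin; zero; suc; toℕ; opposite)
open import Data.Fin.Permutation using (reverse)
open import Data.Fin.Properties using (opposite-prop; toℕ≤pred[n])
open import Data.Integer.Base as ℤ using (+_; -[1+_])
import Data.Integer.Properties as ℤ
open import Data.Nat.Base as ℕ using (ℕ; zero; suc; _≤_; _<_; _∸_; _!; z≤n; s≤s; s≤s⁻¹)
open import Data.Nat.Combinatorics using (_C_; nCk≡n!/k![n-k]!; k![n∸k]!∣n!)
open import Data.Nat.DivMod using (m/n*n≡m)
import Data.Nat.Properties as ℕ
open import Data.Product.Base using (proj₂)
open import Function.Base using (_∘_)
open import Level using (Level)
open import Relation.Binary.PropositionalEquality as ≡ using (_≡_)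
import Relation.Binary.Reasoning.Setoid as SetoidReasoning
open import Defs

private
  variable
    c ℓ : Level

-- The quotient formula for `n C k` involves truncating division; divisibility of `n !` by the
-- denominator makes that division exact.
nCk*[k!*[n∸k]!]≡n! : ∀ {n k} → k ≤ n → (n C k) ℕ.* (k ! ℕ.* (n ∸ k) !) ≡ n !
nCk*[k!*[n∸k]!]≡n! {n} {k} k≤n = ≡.trans
  (≡.cong (ℕ._* (k ! ℕ.* (n ∸ k) !)) (nCk≡n!/k![n-k]! k≤n))
  (m/n*n≡m (k![n∸k]!∣n! k≤n))
  where instance _ = k ℕ.!* (n ∸ k) !≢0

-- Finite sums and Cauchy products of power series

module SeriesProperties (R : CommutativeRing c ℓ) where
  open CommutativeRing R
  open RangeSum R
  open PowerSeries R
  open SumProperties semiring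
  open RingProperties ring using (-0#≈0#)
  open SetoidReasoning setoid

  x-0≈x : ∀ x → x - 0# ≈ x
  x-0≈x x = trans (+-congˡ -0#≈0#) (+-identityʳ x)

  sum-zero : ∀ {n} (t : Fin n → Carrier) → (∀ i → t i ≈ 0#) → sum t ≈ 0#
  sum-zero {n} t t≈0 = trans (sum-cong-≋ t≈0) (sum-replicate-zero n)

  sum-last : ∀ n (f : ℕ → Carrier) →
             sum {suc n} (f ∘ toℕ) ≈ sum {n} (f ∘ toℕ) + f n
  sum-last zero    f = +-comm _ _
  sum-last (suc n) f =
    trans (+-congˡ (sum-last n (f ∘ suc))) (sym (+-assoc _ _ _))

  -- Moves the lower end of a sum from 0 to `k`. For `n < k` truncated subtraction leaves an empty
  -- sum on the right, while every term on the left is zero.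
  sum-dropZeros : ∀ k n (f : ℕ → Carrier) → (∀ l → l < k → f l ≈ 0#) →
                  sum {n} (f ∘ toℕ) ≈ sum {n ∸ k} (λ i → f (k ℕ.+ toℕ i))
  sum-dropZeros zero    n       f f≈0 = refl
  sum-dropZeros (suc k) zero    f f≈0 = refl
  sum-dropZeros (suc k) (suc n) f f≈0 =
    trans (+-cong (f≈0 0 (s≤s z≤n))
                  (sum-dropZeros k n (f ∘ suc) (λ l l<k → f≈0 (suc l) (s≤s l<k))))
          (+-identityˡ _)

  ⊛-comm : ∀ f g n → (f ⊛ g) n ≈ (g ⊛ f) n
  ⊛-comm f g n = begin
    (f ⊛ g) n
      ≈⟨ sum-permute {suc n} (λ i → f (toℕ i) * g (n ∸ toℕ i)) reverse ⟩
    sum {suc n} (λ i → f (toℕ (opposite i)) * g (n ∸ toℕ (opposite i)))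
      ≈⟨ sum-cong-≋ {suc n} reversed ⟩
    (g ⊛ f) n ∎
    where
    reversed : ∀ (i : Fin (suc n)) →
               f (toℕ (opposite i)) * g (n ∸ toℕ (opposite i)) ≈
               g (toℕ i) * f (n ∸ toℕ i)
    -- `opposite i` stands for `n ∸ i`, and `n ∸ (n ∸ i)` is `i` because `i` is at most `n`.
    reversed i rewrite opposite-prop i | ℕ.m∸[m∸n]≡n (toℕ≤pred[n] i) = *-comm _ _

  ⊛-linear-zero : ∀ f a → (f ⊛ (var ⊖ constant a)) 0 ≈ - a * f 0
  ⊛-linear-zero f a =
    trans (+-identityʳ _) (trans (*-comm _ _) (*-congʳ (+-identityˡ _)))

  -- With the linear factor moved to the left, only its coefficients in degrees 0 and 1 contribute;
  -- all later ones compute to `0# - 0#`.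
  ⊛-linear-suc : ∀ f a k →
    (f ⊛ (var ⊖ constant a)) (suc k) ≈ f k + - a * f (suc k)
  ⊛-linear-suc f a k = begin
    (f ⊛ (var ⊖ constant a)) (suc k)
      ≈⟨ ⊛-comm f (var ⊖ constant a) (suc k) ⟩
    (0# - a) * f (suc k) + ((1# - 0#) * f k + sum {k} _)
      ≈⟨ +-cong (*-congʳ (+-identityˡ _))
           (+-cong (trans (*-congʳ (x-0≈x 1#)) (*-identityˡ _))
             (sum-zero {k} _ λ i → trans (*-congʳ (x-0≈x 0#)) (zeroˡ _))) ⟩
    - a * f (suc k) + (f k + 0#)
      ≈⟨ +-congˡ (+-identityʳ _) ⟩
    - a * f (suc k) + f k
      ≈⟨ +-comm _ _ ⟩
    f k + - a * f (suc k) ∎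

  -- In `f ⊛ f ↑ k` the term of index 0 carries the factor `f 0`; every other term takes from
  -- `f ↑ k` a coefficient of degree below `k`, which is zero by induction on `k`.
  ↑-order : ∀ f → f 0 ≈ 0# → ∀ k l → l < k → (f ↑ k) l ≈ 0#
  ↑-order f f₀≈0 (suc k) l l<1+k = sum-zero {suc l} _ (vanishes l (s≤s⁻¹ l<1+k))
    where
    vanishes : ∀ l → l ≤ k → (i : Fin (suc l)) →
               f (toℕ i) * (f ↑ k) (l ∸ toℕ i) ≈ 0#
    vanishes l       l≤k zero    = trans (*-congʳ f₀≈0) (zeroˡ _)
    vanishes (suc l) l<k (suc i) =
      trans (*-congˡ (↑-order f f₀≈0 k _ (ℕ.≤-<-trans (ℕ.m∸n≤m l (toℕ i)) l<k)))
            (zeroʳ _)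

-- Stirling numbers of the first kind: recurrence and vanishing

module ℤSeriesProperties = SeriesProperties ℤ.+-*-commutativeRing

S₁-zero : ∀ n → S₁ (suc n) 0 ≡ ℤ.- (+ n) ℤ.* S₁ n 0
S₁-zero n = ℤSeriesProperties.⊛-linear-zero (fallingPolynomial n) (+ n)

-- The triangular recurrence is multiplication by x - n, read off coefficient by coefficient.
S₁-suc : ∀ n k → S₁ (suc n) (suc k) ≡ S₁ n k ℤ.+ ℤ.- (+ n) ℤ.* S₁ n (suc k)
S₁-suc n = ℤSeriesProperties.⊛-linear-suc (fallingPolynomial n) (+ n)

-- This is the degree bound for the falling factorial, which its encoding as an infinite series does
-- not show.
n<k⇒S₁≡0 : ∀ {n k} → n < k → S₁ n k ≡ ℤ.0ℤ
n<k⇒S₁≡0 {zero}  {suc k} _   = ≡.refl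
n<k⇒S₁≡0 {suc n} {suc k} n<k = begin
  S₁ (suc n) (suc k)
    ≡⟨ S₁-suc n k ⟩
  S₁ n k ℤ.+ ℤ.- (+ n) ℤ.* S₁ n (suc k)
    ≡⟨ ≡.cong₂ (λ i j → i ℤ.+ ℤ.- (+ n) ℤ.* j)
         (n<k⇒S₁≡0 (s≤s⁻¹ n<k)) (n<k⇒S₁≡0 (ℕ.m<n⇒m<1+n (s≤s⁻¹ n<k))) ⟩
  ℤ.0ℤ ℤ.+ ℤ.- (+ n) ℤ.* ℤ.0ℤ
    ≡⟨ ℤ.+-identityˡ _ ⟩
  ℤ.- (+ n) ℤ.* ℤ.0ℤ
    ≡⟨ ℤ.*-zeroʳ (ℤ.- (+ n)) ⟩
  ℤ.0ℤ ∎
  where open ≡.≡-Reasoning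

module DegenerateProperties (A : ℚAlgebra c ℓ) where
  open ℚAlgebra A
  open Degenerate A
  open PowerSeries commutativeRing
  open SeriesProperties commutativeRing
  open SumProperties semiring
    using (sum-cong-≋; ∑-distrib-+; *-distribˡ-sum; *-distribʳ-sum)
  open MultProperties semiring using (×-congʳ; ×-homo-+; ×-assoc-*; ×1-homo-*)
  open RingProperties ring using (-0#≈0#; -‿distribˡ-*; -‿involutive)
  open AbelianGroupProperties +-abelianGroup using (⁻¹-∙-comm)
  open SetoidReasoning setoid
  open SemiringSolver commutativeSemiring using (solve; _:=_; _:+_; _:*_)

  -- The map from the integers to the ring, and the expansion of the degenerate falling factorial

  ×≈fromℕ* : ∀ n x → n × x ≈ fromℕ n * x
  ×≈fromℕ* n x = sym (trans (×-assoc-* n 1# x) (×-congʳ n (*-identityˡ x)))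

  -- Integer addition with mixed signs computes to `⊖`, so this settles those two cases of
  -- `fromℤ-+`.
  fromℤ-⊖ : ∀ m n → fromℤ (m ℤ.⊖ n) ≈ fromℕ m - fromℕ n
  fromℤ-⊖ m       zero    = sym (x-0≈x _)
  fromℤ-⊖ zero    (suc n) = sym (+-identityˡ _)
  fromℤ-⊖ (suc m) (suc n) = begin
    fromℤ (suc m ℤ.⊖ suc n)
      ≡⟨ ≡.cong fromℤ (ℤ.[1+m]⊖[1+n]≡m⊖n m n) ⟩
    fromℤ (m ℤ.⊖ n)
      ≈⟨ fromℤ-⊖ m n ⟩
    fromℕ m - fromℕ n
      -- Inserting 1 - 1 supplies one unit to each of the two naturals.
      ≈⟨ +-identityˡ _ ⟨
    0# + (fromℕ m - fromℕ n)
      ≈⟨ +-congʳ (-‿inverseʳ 1#) ⟨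
    (1# - 1#) + (fromℕ m - fromℕ n)
      ≈⟨ solve 4 (λ a b x y → ((a :+ b) :+ (x :+ y)) := ((a :+ x) :+ (b :+ y))) refl
           1# (- 1#) (fromℕ m) (- fromℕ n) ⟩
    fromℕ (suc m) + (- 1# - fromℕ n)
      ≈⟨ +-congˡ (⁻¹-∙-comm 1# (fromℕ n)) ⟩
    fromℕ (suc m) - fromℕ (suc n) ∎

  fromℤ-+ : ∀ i j → fromℤ (i ℤ.+ j) ≈ fromℤ i + fromℤ j
  fromℤ-+ (+ m)    (+ n)    = ×-homo-+ 1# m n
  fromℤ-+ (+ m)    -[1+ n ] = fromℤ-⊖ m (suc n)
  fromℤ-+ -[1+ m ] (+ n)    = trans (fromℤ-⊖ n (suc m)) (+-comm _ _)
  fromℤ-+ -[1+ m ] -[1+ n ] = begin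
    - fromℕ (suc (suc (m ℕ.+ n)))
      ≡⟨ ≡.cong (λ k → - fromℕ (suc k)) (ℕ.+-suc m n) ⟨
    - fromℕ (suc m ℕ.+ suc n)
      ≈⟨ -‿cong (×-homo-+ 1# (suc m) (suc n)) ⟩
    - (fromℕ (suc m) + fromℕ (suc n))
      ≈⟨ ⁻¹-∙-comm _ _ ⟨
    - fromℕ (suc m) - fromℕ (suc n) ∎

  fromℤ-neg : ∀ i → fromℤ (ℤ.- i) ≈ - fromℤ i
  fromℤ-neg (+ zero)  = sym -0#≈0#
  fromℤ-neg (+ suc n) = refl
  fromℤ-neg -[1+ n ]  = sym (-‿involutive _)

  -- The recurrence for `S₁` multiplies only by the negative of a natural number, so induction on
  -- `n` with additivity gives the multiplicativity it calls for.
  fromℤ-+* : ∀ n i → fromℤ (+ n ℤ.* i) ≈ fromℕ n * fromℤ i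
  fromℤ-+* zero    i = sym (zeroˡ _)
  fromℤ-+* (suc n) i = begin
    fromℤ (+ suc n ℤ.* i)           ≡⟨ ≡.cong fromℤ (ℤ.suc-* (+ n) i) ⟩
    fromℤ (i ℤ.+ + n ℤ.* i)         ≈⟨ fromℤ-+ i (+ n ℤ.* i) ⟩
    fromℤ i + fromℤ (+ n ℤ.* i)     ≈⟨ +-cong (sym (*-identityˡ _)) (fromℤ-+* n i) ⟩
    1# * fromℤ i + fromℕ n * fromℤ i ≈⟨ distribʳ _ _ _ ⟨
    fromℕ (suc n) * fromℤ i         ∎

  fromℤ-neg+* : ∀ n i → fromℤ (ℤ.- (+ n) ℤ.* i) ≈ - fromℕ n * fromℤ i
  fromℤ-neg+* n i = begin
    fromℤ (ℤ.- (+ n) ℤ.* i)   ≡⟨ ≡.cong fromℤ (ℤ.neg-distribˡ-* (+ n) i) ⟨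
    fromℤ (ℤ.- (+ n ℤ.* i))   ≈⟨ fromℤ-neg (+ n ℤ.* i) ⟩
    - fromℤ (+ n ℤ.* i)       ≈⟨ -‿cong (fromℤ-+* n i) ⟩
    - (fromℕ n * fromℤ i)     ≈⟨ -‿distribˡ-* _ _ ⟩
    - fromℕ n * fromℤ i       ∎

  -- Induction on `j` along the recurrence of `S₁`: in the new factor y - jμ, the summand y shifts
  -- `m` by one, and -jμ keeps `m` and raises the exponent of `μ`.
  falling-expansion : ∀ y μ j →
    falling y μ j ≈ (∑[ m ∈ 0 ⋯ j ] (fromℤ (S₁ j m) * y ^ m * μ ^ (j ∸ m)))
  falling-expansion y μ zero =
    sym (trans (+-identityʳ _)
        (trans (*-identityʳ _) (trans (*-identityʳ _) (+-identityʳ 1#))))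
  falling-expansion y μ (suc j) = begin
    falling y μ j * (y - j × μ)
      ≈⟨ *-cong (falling-expansion y μ j) (+-congˡ (-‿cong (×≈fromℕ* j μ))) ⟩
    P * (y - J * μ)
      ≈⟨ trans (distribˡ P y _) (+-congˡ (*-congˡ (-‿distribˡ-* J μ))) ⟩
    P * y + P * (- J * μ)
      ≈⟨ +-congˡ (solve 3 (λ p x u → (p :* (x :* u)) := (x :* (p :* u))) refl P (- J) μ) ⟩
    P * y + - J * (P * μ)
      -- `Pμ≈Q` pads the second sum with a zero last term. Once `q 0` is split off, both sums have
      -- `suc j` terms and combine termwise.
      ≈⟨ +-cong (*-distribʳ-sum {suc j} y (p ∘ toℕ)) (*-congˡ Pμ≈Q) ⟩
    sum {suc j} (λ i → p (toℕ i) * y) + - J * (q 0 + sum {suc j} (q ∘ suc ∘ toℕ))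
      ≈⟨ +-congˡ (trans (distribˡ _ _ _)
           (+-congˡ (*-distribˡ-sum {suc j} (- J) (q ∘ suc ∘ toℕ)))) ⟩
    sum {suc j} (λ i → p (toℕ i) * y)
      + (- J * q 0 + sum {suc j} (λ i → - J * q (suc (toℕ i))))
      ≈⟨ solve 3 (λ a b d → (a :+ (b :+ d)) := (b :+ (a :+ d))) refl _ _ _ ⟩
    - J * q 0 + (sum {suc j} (λ i → p (toℕ i) * y)
      + sum {suc j} (λ i → - J * q (suc (toℕ i))))
      ≈⟨ +-cong first (sym (∑-distrib-+ {suc j} (λ i → p (toℕ i) * y)
           (λ i → - J * q (suc (toℕ i))))) ⟩
    p′ 0 + sum {suc j} (λ i → p (toℕ i) * y + - J * q (suc (toℕ i)))
      ≈⟨ +-congˡ (sum-cong-≋ {suc j} (λ i → next (toℕ i))) ⟩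
    p′ 0 + sum {suc j} (p′ ∘ suc ∘ toℕ) ∎
    where
    J = fromℕ j

    p q p′ : ℕ → Carrier
    p  m = fromℤ (S₁ j m) * y ^ m * μ ^ (j ∸ m)
    q  m = fromℤ (S₁ j m) * y ^ m * μ ^ (suc j ∸ m)
    p′ m = fromℤ (S₁ (suc j) m) * y ^ m * μ ^ (suc j ∸ m)

    P = sum {suc j} (p ∘ toℕ)

    pμ≈q : ∀ m → m ≤ j → p m * μ ≈ q m
    -- The bound on `m` turns `suc j ∸ m` into `suc (j ∸ m)`, which exposes one more factor `μ`.
    pμ≈q m m≤j rewrite ℕ.+-∸-assoc 1 m≤j =
      trans (*-assoc _ _ _) (*-congˡ (*-comm _ _))

    q-last : q (suc j) ≈ 0#
    -- Here the exponent of `μ` is 0, so the zero comes from `S₁ j (suc j)`.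
    q-last = trans
      (*-congʳ (*-congʳ (reflexive (≡.cong fromℤ (n<k⇒S₁≡0 (ℕ.n<1+n j))))))
      (trans (*-congʳ (zeroˡ _)) (zeroˡ _))

    Pμ≈Q : P * μ ≈ sum {suc (suc j)} (q ∘ toℕ)
    Pμ≈Q = begin
      P * μ
        ≈⟨ *-distribʳ-sum {suc j} μ (p ∘ toℕ) ⟩
      sum {suc j} (λ i → p (toℕ i) * μ)
        ≈⟨ sum-cong-≋ {suc j} (λ i → pμ≈q (toℕ i) (toℕ≤pred[n] i)) ⟩
      sum {suc j} (q ∘ toℕ)
        ≈⟨ trans (+-congˡ q-last) (+-identityʳ _) ⟨
      sum {suc j} (q ∘ toℕ) + q (suc j)
        ≈⟨ sum-last (suc j) q ⟨
      sum {suc (suc j)} (q ∘ toℕ) ∎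

    first : - J * q 0 ≈ p′ 0
    first = begin
      - J * q 0
        ≈⟨ solve 4 (λ x s u v → (x :* ((s :* u) :* v)) := (((x :* s) :* u) :* v)) refl
             (- J) (fromℤ (S₁ j 0)) 1# (μ ^ suc j) ⟩
      - J * fromℤ (S₁ j 0) * 1# * μ ^ suc j
        ≈⟨ *-congʳ (*-congʳ (fromℤ-neg+* j (S₁ j 0))) ⟨
      fromℤ (ℤ.- (+ j) ℤ.* S₁ j 0) * 1# * μ ^ suc j
        ≈⟨ *-congʳ (*-congʳ (reflexive (≡.cong fromℤ (S₁-zero j)))) ⟨
      p′ 0 ∎

    next : ∀ m → p m * y + - J * q (suc m) ≈ p′ (suc m)
    next m = begin
      p m * y + - J * q (suc m)
        -- `suc j ∸ suc m` computes to `j ∸ m`, so both summands share the same power of `μ`.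
        ≈⟨ solve 6 (λ s u v x t z →
               ((((s :* u) :* v) :* z) :+ (x :* ((t :* (z :* u)) :* v)))
             := (((s :+ (x :* t)) :* (z :* u)) :* v)) refl
             (fromℤ (S₁ j m)) (y ^ m) (μ ^ (j ∸ m)) (- J) (fromℤ (S₁ j (suc m))) y ⟩
      (fromℤ (S₁ j m) + - J * fromℤ (S₁ j (suc m))) * y ^ suc m * μ ^ (j ∸ m)
        ≈⟨ *-congʳ (*-congʳ (trans (fromℤ-+ (S₁ j m) _)
             (+-congˡ (fromℤ-neg+* j (S₁ j (suc m)))))) ⟨
      fromℤ (S₁ j m ℤ.+ ℤ.- (+ j) ℤ.* S₁ j (suc m)) * y ^ suc m * μ ^ (j ∸ m)
        ≈⟨ *-congʳ (*-congʳ (reflexive (≡.cong fromℤ (S₁-suc j m)))) ⟨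
      p′ (suc m) ∎

  -- Factorials, order of the series, and the binomial convolution

  !-inverseʳ : ∀ n → fromℕ (n !) * 1/ n ! ≈ 1#
  !-inverseʳ n = proj₂ (proj₂ (invertible (n !) {{n ℕ.!≢0}}))

  fromℕ-! : ∀ {n l} → l ≤ n →
            fromℕ (n !) ≈ fromℕ (n C l) * (fromℕ (l !) * fromℕ ((n ∸ l) !))
  fromℕ-! {n} {l} l≤n = begin
    fromℕ (n !)
      ≡⟨ ≡.cong fromℕ (nCk*[k!*[n∸k]!]≡n! l≤n) ⟨
    fromℕ ((n C l) ℕ.* (l ! ℕ.* (n ∸ l) !))
      ≈⟨ trans (×1-homo-* (n C l) _) (*-congˡ (×1-homo-* (l !) _)) ⟩
    fromℕ (n C l) * (fromℕ (l !) * fromℕ ((n ∸ l) !)) ∎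

  -- `1/ 0 !` is an inverse supplied by the structure and does not compute to `1#`; the inverse law
  -- identifies it.
  degExp-0 : ∀ μ y → degExp μ y 0 ≈ 1#
  degExp-0 μ y = begin
    1# * 1/ 0 !        ≈⟨ *-congʳ (+-identityʳ 1#) ⟨
    fromℕ 1 * 1/ 0 !   ≈⟨ !-inverseʳ 0 ⟩
    1#                 ∎

  -- The base of the `k`-th power has zero constant term, so `↑-order` applies.
  S₂-order : ∀ μ {l k} → l < k → S₂ μ l k ≈ 0#
  S₂-order μ {l} {k} l<k = begin
    (l !) × (1/ k ! * G l)         ≈⟨ ×≈fromℕ* (l !) _ ⟩
    fromℕ (l !) * (1/ k ! * G l)   ≈⟨ *-congˡ (*-congˡ (↑-order _ E₀-1≈0 k l l<k)) ⟩
    fromℕ (l !) * (1/ k ! * 0#)    ≈⟨ trans (*-congˡ (zeroʳ _)) (zeroʳ _) ⟩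
    0#                             ∎
    where
    G = (degExp μ 1# ⊖ constant 1#) ↑ k

    E₀-1≈0 : degExp μ 1# 0 - 1# ≈ 0#
    E₀-1≈0 = trans (+-congʳ (degExp-0 μ 1#)) (-‿inverseʳ 1#)

  S₂ᵣ-convolution : ∀ μ r n k →
    S₂ᵣ μ r n k ≈
      (∑[ l ∈ 0 ⋯ n ] (fromℕ (n C l) * falling (fromℕ r) μ (n ∸ l) * S₂ μ l k))
  S₂ᵣ-convolution μ r n k = begin
    (n !) × (1/ k ! * (E ⊛ G) n)
      -- Commuting the factors attaches the index `l` to the `k`-th power and `n ∸ l` to the
      -- exponential, as the target sum has it.
      ≈⟨ trans (×≈fromℕ* (n !) _) (*-congˡ (*-congˡ (⊛-comm E G n))) ⟩
    fromℕ (n !) * (1/ k ! * (G ⊛ E) n)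
      ≈⟨ *-assoc _ _ _ ⟨
    fromℕ (n !) * 1/ k ! * (G ⊛ E) n
      ≈⟨ *-distribˡ-sum {suc n} _ (λ i → G (toℕ i) * E (n ∸ toℕ i)) ⟩
    sum {suc n} (λ i → fromℕ (n !) * 1/ k ! * (G (toℕ i) * E (n ∸ toℕ i)))
      ≈⟨ sum-cong-≋ {suc n} (λ i → term (toℕ i) (toℕ≤pred[n] i)) ⟩
    (∑[ l ∈ 0 ⋯ n ] (fromℕ (n C l) * falling (fromℕ r) μ (n ∸ l) * S₂ μ l k)) ∎
    where
    E = degExp μ (fromℕ r)
    G = (degExp μ 1# ⊖ constant 1#) ↑ k

    term : ∀ l → l ≤ n →
           fromℕ (n !) * 1/ k ! * (G l * E (n ∸ l)) ≈
           fromℕ (n C l) * falling (fromℕ r) μ (n ∸ l) * S₂ μ l k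
    term l l≤n = begin
      fromℕ (n !) * 1/ k ! * (G l * (φ * 1/ (n ∸ l) !))
        ≈⟨ *-congʳ (*-congʳ (fromℕ-! l≤n)) ⟩
      b * (fromℕ (l !) * fromℕ ((n ∸ l) !)) * 1/ k ! * (G l * (φ * 1/ (n ∸ l) !))
        -- After the splitting of `n !`, the factor `l !` joins `1/ k !` and `G l` to form
        -- `S₂ μ l k`, and `(n ∸ l) !` meets its inverse.
        ≈⟨ solve 7 (λ b x d e g φ d′ →
               (((b :* (x :* d)) :* e) :* (g :* (φ :* d′)))
             := (((b :* φ) :* (x :* (e :* g))) :* (d :* d′))) refl
             b (fromℕ (l !)) (fromℕ ((n ∸ l) !)) (1/ k !) (G l) φ (1/ (n ∸ l) !) ⟩
      b * φ * (fromℕ (l !) * (1/ k ! * G l)) * (fromℕ ((n ∸ l) !) * 1/ (n ∸ l) !)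
        ≈⟨ trans (*-congˡ (!-inverseʳ (n ∸ l))) (*-identityʳ _) ⟩
      b * φ * (fromℕ (l !) * (1/ k ! * G l))
        ≈⟨ *-congˡ (×≈fromℕ* (l !) _) ⟨
      b * φ * S₂ μ l k ∎
      where
      b = fromℕ (n C l)
      φ = falling (fromℕ r) μ (n ∸ l)

  falling-distribute : ∀ y μ n l b s →
    b * falling y μ (n ∸ l) * s ≈
      (∑[ m ∈ 0 ⋯ (n ∸ l) ]
        (b * y ^ m * μ ^ (n ∸ m ∸ l) * fromℤ (S₁ (n ∸ l) m) * s))
  falling-distribute y μ n l b s = begin
    b * falling y μ (n ∸ l) * s
      ≈⟨ *-congʳ (*-congˡ (falling-expansion y μ (n ∸ l))) ⟩
    b * sum {suc (n ∸ l)} (p ∘ toℕ) * s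
      ≈⟨ *-congʳ (*-distribˡ-sum {suc (n ∸ l)} b (p ∘ toℕ)) ⟩
    sum {suc (n ∸ l)} (λ i → b * p (toℕ i)) * s
      ≈⟨ *-distribʳ-sum {suc (n ∸ l)} s (λ i → b * p (toℕ i)) ⟩
    sum {suc (n ∸ l)} (λ i → b * p (toℕ i) * s)
      ≈⟨ sum-cong-≋ {suc (n ∸ l)} (λ i → term (toℕ i)) ⟩
    (∑[ m ∈ 0 ⋯ (n ∸ l) ]
      (b * y ^ m * μ ^ (n ∸ m ∸ l) * fromℤ (S₁ (n ∸ l) m) * s)) ∎
    where
    p : ℕ → Carrier
    p m = fromℤ (S₁ (n ∸ l) m) * y ^ m * μ ^ (n ∸ l ∸ m)

    ∸-swap : ∀ m → n ∸ l ∸ m ≡ n ∸ m ∸ l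
    -- Both sides equal `n` minus the sum of `l` and `m`; this also holds when the subtraction
    -- truncates.
    ∸-swap m = ≡.trans (ℕ.∸-+-assoc n l m)
      (≡.trans (≡.cong (n ∸_) (ℕ.+-comm l m)) (≡.sym (ℕ.∸-+-assoc n m l)))

    term : ∀ m → b * p m * s ≈
                 b * y ^ m * μ ^ (n ∸ m ∸ l) * fromℤ (S₁ (n ∸ l) m) * s
    term m rewrite ∸-swap m = *-congʳ
      (solve 4 (λ b σ u v → (b :* ((σ :* u) :* v)) := (((b :* u) :* v) :* σ)) refl
        b (fromℤ (S₁ (n ∸ l) m)) (y ^ m) (μ ^ (n ∸ m ∸ l)))

theorem2p1 : {c ℓ : Level} (A : ℚAlgebra c ℓ) →
  let open ℚAlgebra A
      open Degenerate A
  in (μ : Carrier) (r n k : ℕ) → k ≤ n →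
     S₂ᵣ μ r n k
       ≈ (∑[ l ∈ k ⋯ n ] (∑[ m ∈ 0 ⋯ (n ∸ l) ]
            (fromℕ (n C l) * fromℕ r ^ m * μ ^ (n ∸ m ∸ l)
              * fromℤ (S₁ (n ∸ l) m) * S₂ μ l k)))
theorem2p1 A μ r n k _ = begin
  S₂ᵣ μ r n k
    ≈⟨ S₂ᵣ-convolution μ r n k ⟩
  (∑[ l ∈ 0 ⋯ n ] T l)
    -- The range from 0 to `n` has `suc n` terms; the `suc n ∸ k` that remain are by definition the
    -- range from `k` to `n`.
    ≈⟨ sum-dropZeros k (suc n) T
         (λ l l<k → trans (*-congˡ (S₂-order μ l<k)) (zeroʳ _)) ⟩
  (∑[ l ∈ k ⋯ n ] T l)
    ≈⟨ sum-cong-≋ {suc n ∸ k} (λ i → let l = k ℕ.+ toℕ i in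
         falling-distribute (fromℕ r) μ n l (fromℕ (n C l)) (S₂ μ l k)) ⟩
  (∑[ l ∈ k ⋯ n ] (∑[ m ∈ 0 ⋯ (n ∸ l) ]
    (fromℕ (n C l) * fromℕ r ^ m * μ ^ (n ∸ m ∸ l)
      * fromℤ (S₁ (n ∸ l) m) * S₂ μ l k))) ∎
  where
  open ℚAlgebra A
  open Degenerate A
  open DegenerateProperties A
  open SeriesProperties commutativeRing using (sum-dropZeros)
  open SumProperties semiring using (sum-cong-≋)
  open SetoidReasoning setoid

  T : ℕ → Carrier
  T l = fromℕ (n C l) * falling (fromℕ r) μ (n ∸ l) * S₂ μ l k
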